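{- Let $f=c_1\wedge\cdots\wedge c_m$ be a Boolean formula over the variables $x_1,\dots,x_n$, where each clause $c_j$ is a CNF clause, a cardinality constraint, an XOR clause, or a NAE clause. Let $F_f=\sum_{j=1}^m \mathrm{FE}_{c_j}$, viewed as a real polynomial on $[-1,1]^n$. Then $f$ is satisfiable if and only if $\min_{x\in[-1,1]^n}F_f(x)=-m$.
   Context: Boolean values are encoded as $\pm1$, with $-1$ standing for True and $+1$ for False; a negated literal $\neg x_i$ corresponds to $-x_i$. The clause types are as follows. - A CNF clause is a disjunction of literals. - A cardinality constraint $D^{\ge k}(L)$ (respectively $D^{\le k}(L)$) on a set $L$ of variables requires at least (respectively at most) $k$ of them to be True. - An XOR clause requires an odd number of its variables to be True. - A NAE clause requires that not all of its variables take the same value. Each clause $c$ is a function $\{\pm1\}^n\to\{\pm1\}$, with value $-1$ exactly when $c$ is satisfied. $\mathrm{FE}_c$ denotes its Fourier expansion: the unique multilinear polynomial $\sum_{S\subseteq[n]}\widehat c(S)\prod_{i\in S}x_i$ that agrees with $c$ on $\{\pm1\}^n$, where $\widehat c(S)=\mathbb{E}_{x\sim\{\pm1\}^n}[c(x)\prod_{i\in S}x_i]$. -}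

module Defs where

open import Data.Bool.Base using (if_then_else_)
open import Data.Fin.Base using (Fin)
open import Data.Fin.Properties using (all?)
open import Data.Fin.Subset using (Subset; inside; outside; _∈_; _∩_; ∣_∣)
open import Data.Fin.Subset.Properties using (_∈?_)
open import Data.Integer.Base as ℤ using (ℤ; _◃_)
open import Data.List.Base as List using (List; []; _∷_; cartesianProductWith)
open import Data.List.Relation.Unary.Any using (Any; any?)
open import Data.Nat.Base as ℕ using (ℕ; zero; suc; _⊔_)
import Data.Nat.Properties as ℕ
open import Data.Product.Base using (Σ; ∃; _×_; _,_)
open import Data.Rational.Base as ℚ using (ℚ; 0ℚ; 1ℚ; ½)
import Data.Rational.Properties as ℚ
open import Data.Rational.Solver using (module +-*-Solver)
open import Data.Sign.Base as Sign using (Sign; opposite)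
open import Data.Sign.Properties as Sign using (_≟_)
open import Data.Vec.Base as Vec using (Vec; []; _∷_; lookup; zipWith)
open import Data.Vec.Relation.Unary.All using (All)
open import Relation.Binary.PropositionalEquality
  using (_≡_; refl; sym; trans; cong; cong₂; subst)
open import Relation.Nullary using (Dec; ¬_; does; ¬?; _→-dec_)

-- Real numbers are Cauchy sequences of rationals, with equality as a
-- setoid relation.  The existential in `IsCauchy` is a Σ-type, so every
-- real carries a modulus of convergence.

EventuallyWithin : ℚ → (ℕ → ℚ) → Set
EventuallyWithin ε s =
  ∃ λ N → ∀ m n → N ℕ.≤ m → N ℕ.≤ n → ℚ.∣ s m ℚ.- s n ∣ ℚ.≤ ε

IsCauchy : (ℕ → ℚ) → Set
IsCauchy s = ∀ ε → 0ℚ ℚ.< ε → EventuallyWithin ε s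

record ℝ : Set where
  field
    seq    : ℕ → ℚ
    cauchy : IsCauchy seq

open ℝ public

infix 4 _≈_ _≤_

_≈_ : ℝ → ℝ → Set
x ≈ y = ∀ ε → 0ℚ ℚ.< ε →
        ∃ λ N → ∀ n → N ℕ.≤ n → ℚ.∣ seq x n ℚ.- seq y n ∣ ℚ.≤ ε

_≤_ : ℝ → ℝ → Set
x ≤ y = ∀ ε → 0ℚ ℚ.< ε → ∃ λ N → ∀ n → N ℕ.≤ n → seq x n ℚ.≤ seq y n ℚ.+ ε

fromℚ : ℚ → ℝ
fromℚ q .seq _ = q
fromℚ q .cauchy ε 0<ε = 0 , λ _ _ _ _ →
  subst (λ r → ℚ.∣ r ∣ ℚ.≤ ε) (sym (ℚ.+-inverseʳ q)) (ℚ.<⇒≤ 0<ε)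

infixl 6 _+_
infixl 7 _*_

private

  half-pos : ∀ {ε} → 0ℚ ℚ.< ε → 0ℚ ℚ.< ½ ℚ.* ε
  half-pos {ε} 0<ε =
    ℚ.positive⁻¹ _ {{ℚ.pos*pos⇒pos ½ ε {{ℚ.positive 0<ε}}}}

  halves : ∀ ε → ½ ℚ.* ε ℚ.+ ½ ℚ.* ε ≡ ε
  halves ε = trans (sym (ℚ.*-distribʳ-+ ε ½ ½)) (ℚ.*-identityˡ ε)

  *-mono-≤ : ∀ {p q r s} → 0ℚ ℚ.≤ r → 0ℚ ℚ.≤ q →
             p ℚ.≤ q → r ℚ.≤ s → p ℚ.* r ℚ.≤ q ℚ.* s
  *-mono-≤ {q = q} {r} 0≤r 0≤q p≤q r≤s = ℚ.≤-trans
    (ℚ.*-monoʳ-≤-nonNeg r {{ℚ.nonNegative 0≤r}} p≤q)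
    (ℚ.*-monoˡ-≤-nonNeg q {{ℚ.nonNegative 0≤q}} r≤s)

  Bounded : (ℕ → ℚ) → Set
  Bounded s = Σ ℚ λ B → 0ℚ ℚ.< B × ∃ λ N → ∀ n → N ℕ.≤ n → ℚ.∣ s n ∣ ℚ.≤ B

  bounded : ∀ x → Bounded (seq x)
  bounded x with cauchy x 1ℚ (ℚ.positive⁻¹ 1ℚ)
  ... | N , close = 1ℚ ℚ.+ ℚ.∣ seq x N ∣
    , ℚ.+-mono-<-≤ (ℚ.positive⁻¹ 1ℚ) (ℚ.0≤∣p∣ (seq x N))
    , N , λ n N≤n → begin
        ℚ.∣ seq x n ∣                              ≡⟨ cong ℚ.∣_∣ (split (seq x n) (seq x N)) ⟩
        ℚ.∣ (seq x n ℚ.- seq x N) ℚ.+ seq x N ∣    ≤⟨ ℚ.∣p+q∣≤∣p∣+∣q∣ (seq x n ℚ.- seq x N) (seq x N) ⟩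
        ℚ.∣ seq x n ℚ.- seq x N ∣ ℚ.+ ℚ.∣ seq x N ∣ ≤⟨ ℚ.+-monoˡ-≤ ℚ.∣ seq x N ∣ (close n N N≤n ℕ.≤-refl) ⟩
        1ℚ ℚ.+ ℚ.∣ seq x N ∣                       ∎
    where
    open ℚ.≤-Reasoning
    split : ∀ a b → a ≡ (a ℚ.- b) ℚ.+ b
    split = solve 2 (λ a b → a := (a :- b) :+ b) refl
      where open +-*-Solver

  split-tolerance : ∀ A B ε → 0ℚ ℚ.< A → 0ℚ ℚ.< B → 0ℚ ℚ.< ε →
                    Σ ℚ λ δ → 0ℚ ℚ.< δ × A ℚ.* δ ℚ.+ δ ℚ.* B ≡ ε
  split-tolerance A B ε 0<A 0<B 0<ε = ε ℚ.* r , 0<ε*r , (begin-equality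
    A ℚ.* (ε ℚ.* r) ℚ.+ (ε ℚ.* r) ℚ.* B   ≡⟨ collect A B ε r ⟩
    ε ℚ.* (r ℚ.* (A ℚ.+ B))               ≡⟨ cong (ε ℚ.*_) (ℚ.*-inverseˡ (A ℚ.+ B) {{≢0}}) ⟩
    ε ℚ.* 1ℚ                              ≡⟨ ℚ.*-identityʳ ε ⟩
    ε                                     ∎)
    where
    open ℚ.≤-Reasoning
    A+B-pos : ℚ.Positive (A ℚ.+ B)
    A+B-pos = ℚ.pos+pos⇒pos A {{ℚ.positive 0<A}} B {{ℚ.positive 0<B}}
    ≢0 : ℚ.NonZero (A ℚ.+ B)
    ≢0 = ℚ.pos⇒nonZero (A ℚ.+ B) {{A+B-pos}}
    r : ℚ
    r = ℚ.1/_ (A ℚ.+ B) {{≢0}}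
    0<ε*r : 0ℚ ℚ.< ε ℚ.* r
    0<ε*r = ℚ.positive⁻¹ (ε ℚ.* r)
      {{ℚ.pos*pos⇒pos ε {{ℚ.positive 0<ε}} r {{ℚ.1/pos⇒pos (A ℚ.+ B) {{A+B-pos}}}}}}
    collect : ∀ a b e r →
      a ℚ.* (e ℚ.* r) ℚ.+ (e ℚ.* r) ℚ.* b ≡ e ℚ.* (r ℚ.* (a ℚ.+ b))
    collect = solve 4 (λ a b e r →
      a :* (e :* r) :+ (e :* r) :* b := e :* (r :* (a :+ b))) refl
      where open +-*-Solver

  product-diff : ∀ a b c d → ℚ.∣ a ℚ.* b ℚ.- c ℚ.* d ∣ ℚ.≤
                 ℚ.∣ a ∣ ℚ.* ℚ.∣ b ℚ.- d ∣ ℚ.+ ℚ.∣ a ℚ.- c ∣ ℚ.* ℚ.∣ d ∣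
  product-diff a b c d = begin
    ℚ.∣ a ℚ.* b ℚ.- c ℚ.* d ∣
      ≡⟨ cong ℚ.∣_∣ (rearrange a b c d) ⟩
    ℚ.∣ a ℚ.* (b ℚ.- d) ℚ.+ (a ℚ.- c) ℚ.* d ∣
      ≤⟨ ℚ.∣p+q∣≤∣p∣+∣q∣ (a ℚ.* (b ℚ.- d)) ((a ℚ.- c) ℚ.* d) ⟩
    ℚ.∣ a ℚ.* (b ℚ.- d) ∣ ℚ.+ ℚ.∣ (a ℚ.- c) ℚ.* d ∣
      ≡⟨ cong₂ ℚ._+_ (ℚ.∣p*q∣≡∣p∣*∣q∣ a (b ℚ.- d)) (ℚ.∣p*q∣≡∣p∣*∣q∣ (a ℚ.- c) d) ⟩
    ℚ.∣ a ∣ ℚ.* ℚ.∣ b ℚ.- d ∣ ℚ.+ ℚ.∣ a ℚ.- c ∣ ℚ.* ℚ.∣ d ∣ ∎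
    where
    open ℚ.≤-Reasoning
    rearrange : ∀ a b c d →
      a ℚ.* b ℚ.- c ℚ.* d ≡ a ℚ.* (b ℚ.- d) ℚ.+ (a ℚ.- c) ℚ.* d
    rearrange = solve 4 (λ a b c d →
      a :* b :- c :* d := a :* (b :- d) :+ (a :- c) :* d) refl
      where open +-*-Solver

  *-cauchy : ∀ {s t} → Bounded s → Bounded t → IsCauchy s → IsCauchy t →
             IsCauchy (λ n → s n ℚ.* t n)
  *-cauchy {s} {t} (A , 0<A , K , ∣s∣≤A) (B , 0<B , L , ∣t∣≤B) cauchyˢ cauchyᵗ ε 0<ε =
    finish (split-tolerance A B ε 0<A 0<B 0<ε)
    where
    close : ∀ δ → 0ℚ ℚ.≤ δ → A ℚ.* δ ℚ.+ δ ℚ.* B ≡ ε →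
            EventuallyWithin δ s → EventuallyWithin δ t →
            EventuallyWithin ε (λ n → s n ℚ.* t n)
    close δ 0≤δ total (M , closeˢ) (N , closeᵗ) = (K ⊔ L) ⊔ (M ⊔ N) , λ m n ≤m ≤n →
      let KL≤m = ℕ.m⊔n≤o⇒m≤o (K ⊔ L) (M ⊔ N) ≤m
          KL≤n = ℕ.m⊔n≤o⇒m≤o (K ⊔ L) (M ⊔ N) ≤n
          MN≤m = ℕ.m⊔n≤o⇒n≤o (K ⊔ L) (M ⊔ N) ≤m
          MN≤n = ℕ.m⊔n≤o⇒n≤o (K ⊔ L) (M ⊔ N) ≤n
          bound₁ = *-mono-≤ (ℚ.0≤∣p∣ (t m ℚ.- t n)) (ℚ.<⇒≤ 0<A)
            (∣s∣≤A m (ℕ.m⊔n≤o⇒m≤o K L KL≤m))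
            (closeᵗ m n (ℕ.m⊔n≤o⇒n≤o M N MN≤m) (ℕ.m⊔n≤o⇒n≤o M N MN≤n))
          bound₂ = *-mono-≤ (ℚ.0≤∣p∣ (t n)) 0≤δ
            (closeˢ m n (ℕ.m⊔n≤o⇒m≤o M N MN≤m) (ℕ.m⊔n≤o⇒m≤o M N MN≤n))
            (∣t∣≤B n (ℕ.m⊔n≤o⇒n≤o K L KL≤n))
      in ℚ.≤-trans (product-diff (s m) (t m) (s n) (t n))
           (ℚ.≤-trans (ℚ.+-mono-≤ bound₁ bound₂) (ℚ.≤-reflexive total))

    finish : (Σ ℚ λ δ → 0ℚ ℚ.< δ × A ℚ.* δ ℚ.+ δ ℚ.* B ≡ ε) →
             EventuallyWithin ε (λ n → s n ℚ.* t n)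
    finish (δ , 0<δ , total) =
      close δ (ℚ.<⇒≤ 0<δ) total (cauchyˢ δ 0<δ) (cauchyᵗ δ 0<δ)

_+_ : ℝ → ℝ → ℝ
(x + y) .seq n = seq x n ℚ.+ seq y n
(x + y) .cauchy ε 0<ε with cauchy x (½ ℚ.* ε) (half-pos 0<ε)
                         | cauchy y (½ ℚ.* ε) (half-pos 0<ε)
... | M , closeˣ | N , closeʸ = M ⊔ N , λ m n ≤m ≤n → begin
  ℚ.∣ (seq x m ℚ.+ seq y m) ℚ.- (seq x n ℚ.+ seq y n) ∣
    ≡⟨ cong ℚ.∣_∣ (rearrange (seq x m) (seq y m) (seq x n) (seq y n)) ⟩
  ℚ.∣ (seq x m ℚ.- seq x n) ℚ.+ (seq y m ℚ.- seq y n) ∣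
    ≤⟨ ℚ.∣p+q∣≤∣p∣+∣q∣ (seq x m ℚ.- seq x n) (seq y m ℚ.- seq y n) ⟩
  ℚ.∣ seq x m ℚ.- seq x n ∣ ℚ.+ ℚ.∣ seq y m ℚ.- seq y n ∣
    ≤⟨ ℚ.+-mono-≤ (closeˣ m n (ℕ.m⊔n≤o⇒m≤o M N ≤m) (ℕ.m⊔n≤o⇒m≤o M N ≤n))
                  (closeʸ m n (ℕ.m⊔n≤o⇒n≤o M N ≤m) (ℕ.m⊔n≤o⇒n≤o M N ≤n)) ⟩
  ½ ℚ.* ε ℚ.+ ½ ℚ.* ε
    ≡⟨ halves ε ⟩
  ε ∎
  where
  open ℚ.≤-Reasoning
  rearrange : ∀ a b c d → (a ℚ.+ b) ℚ.- (c ℚ.+ d) ≡ (a ℚ.- c) ℚ.+ (b ℚ.- d)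
  rearrange = solve 4 (λ a b c d → (a :+ b) :- (c :+ d) := (a :- c) :+ (b :- d)) refl
    where open +-*-Solver

_*_ : ℝ → ℝ → ℝ
(x * y) .seq n = seq x n ℚ.* seq y n
(x * y) .cauchy = *-cauchy (bounded x) (bounded y) (cauchy x) (cauchy y)

-- v is attained up to _≈_, and is a lower bound.
IsMinimum : {A : Set} → (A → Set) → (A → ℝ) → ℝ → Set
IsMinimum P F v = (∃ λ x → P x × F x ≈ v) × (∀ x → P x → v ≤ F x)

InCube : ∀ {n} → Vec ℝ n → Set
InCube = All λ t → fromℚ (ℚ.- 1ℚ) ≤ t × t ≤ fromℚ 1ℚ

-- Sign.- is True, Sign.+ is False.
Assignment : ℕ → Set
Assignment n = Vec Sign n

data Literal (n : ℕ) : Set where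
  pos neg : Fin n → Literal n

literal : ∀ {n} → Literal n → Assignment n → Sign
literal (pos i) x = lookup x i
literal (neg i) x = opposite (lookup x i)

data Clause (n : ℕ) : Set where
  cnf           : List (Literal n) → Clause n
  card≥ card≤   : (k : ℕ) (L : Subset n) → Clause n
  xor nae       : Subset n → Clause n

trueSet : ∀ {n} → Assignment n → Subset n
trueSet = Vec.map λ s → does (s ≟ Sign.-)

#true : ∀ {n} → Subset n → Assignment n → ℕ
#true L x = ∣ L ∩ trueSet x ∣

Satisfies : ∀ {n} → Assignment n → Clause n → Set
Satisfies x (cnf ls)    = Any (λ l → literal l x ≡ Sign.-) ls
Satisfies x (card≥ k L) = k ℕ.≤ #true L x
Satisfies x (card≤ k L) = #true L x ℕ.≤ k
Satisfies x (xor L)     = #true L x ℕ.% 2 ≡ 1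
Satisfies x (nae L)     = ¬ (∀ i → i ∈ L → ∀ j → j ∈ L → lookup x i ≡ lookup x j)

satisfies? : ∀ {n} (x : Assignment n) (c : Clause n) → Dec (Satisfies x c)
satisfies? x (cnf ls)    = any? (λ l → literal l x ≟ Sign.-) ls
satisfies? x (card≥ k L) = k ℕ.≤? #true L x
satisfies? x (card≤ k L) = #true L x ℕ.≤? k
satisfies? x (xor L)     = #true L x ℕ.% 2 ℕ.≟ 1
satisfies? x (nae L)     = ¬? (all? λ i → (i ∈? L) →-dec
                               all? λ j → (j ∈? L) →-dec (lookup x i ≟ lookup x j))

⟦_⟧ᶜ : ∀ {n} → Clause n → Assignment n → Sign
⟦ c ⟧ᶜ x = if does (satisfies? x c) then Sign.- else Sign.+

Formula : ℕ → ℕ → Set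
Formula n m = Vec (Clause n) m

Satisfiable : ∀ {n m} → Formula n m → Set
Satisfiable f = ∃ λ x → All (Satisfies x) f

allVecs : {A : Set} → List A → ∀ n → List (Vec A n)
allVecs as zero    = [] ∷ []
allVecs as (suc n) = cartesianProductWith _∷_ as (allVecs as n)

allAssignments : ∀ n → List (Assignment n)
allAssignments = allVecs (Sign.- ∷ Sign.+ ∷ [])

allSubsets : ∀ n → List (Subset n)
allSubsets = allVecs (inside ∷ outside ∷ [])

-- ∏ _·_ ε S x is the product of x i over i ∈ S.
∏ : {A : Set} → (A → A → A) → A → ∀ {n} → Subset n → Vec A n → A
∏ _·_ ε S x = Vec.foldr′ _·_ ε (zipWith (λ b a → if b then a else ε) S x)

𝔼 : ∀ {n} → (Assignment n → ℤ) → ℚ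
𝔼 {n} g = List.foldr ℤ._+_ (ℤ.+ 0) (List.map g (allAssignments n)) ℚ./ (2 ℕ.^ n)
  where instance
    2^n≢0 : ℕ.NonZero (2 ℕ.^ n)
    2^n≢0 = ℕ.m^n≢0 2 n

-- Multilinear polynomials in n variables, as families of coefficients.
-- Rational coefficients suffice since Fourier coefficients are dyadic.
Multilinear : ℕ → Set
Multilinear n = Subset n → ℚ

eval : ∀ {n} → Multilinear n → Vec ℝ n → ℝ
eval {n} p x = List.foldr _+_ (fromℚ 0ℚ)
  (List.map (λ S → fromℚ (p S) * ∏ _*_ (fromℚ 1ℚ) S x) (allSubsets n))

-- s ◃ 1 is the integer ±1 with sign s.
FE : ∀ {n} → (Assignment n → Sign) → Multilinear n
FE c S = 𝔼 λ x → (c x Sign.* ∏ Sign._*_ Sign.+ S x) ◃ 1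

F : ∀ {n m} → Formula n m → Multilinear n
F f S = Vec.foldr′ ℚ._+_ 0ℚ (Vec.map (λ c → FE ⟦ c ⟧ᶜ S) f)

{-# OPTIONS --safe #-}

-- Substituting t for the first variable of a multilinear polynomial gives
-- p|t = ½ (1 + t) p|1 + ½ (1 - t) p|-1, so by induction on the number of
-- variables a lower bound on the vertices {±1}ⁿ persists on [-1,1]ⁿ.  At a
-- vertex F f is the sum of the clause values, which is -m at a satisfying
-- assignment and at least 1 - m at any other.

module Submission where

open import Defs
import Algebra.Properties.Group as GroupProperties
open import Algebra.Structures using (IsMonoid)
open import Data.Fin.Subset using (Subset; inside; outside)
open import Data.Integer.Base as ℤ using (ℤ; _◃_)
import Data.Integer.Properties as ℤ
import Data.Integer.Solver as ℤ-Solver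
open import Data.List.Base as List using (List; []; _∷_; _++_)
import Data.List.Properties as List
open import Data.Nat.Base as ℕ using (zero; suc; _⊔_)
import Data.Nat.Properties as ℕ
open import Data.Product.Base using (∃; _×_; _,_)
open import Data.Rational.Base as ℚ using (ℚ; 0ℚ; 1ℚ; ½)
import Data.Rational.Properties as ℚ
open import Data.Rational.Solver using (module +-*-Solver)
open import Data.Rational.Unnormalised.Base as ℚᵘ using (mkℚᵘ; *≡*)
import Data.Rational.Unnormalised.Properties as ℚᵘ
open import Data.Sign.Base as Sign using (Sign; opposite)
import Data.Sign.Properties as Sign
open import Data.Sum.Base using (inj₁; inj₂; [_,_]′)
open import Data.Vec.Base as Vec using (Vec; []; _∷_)
import Data.Vec.Properties as Vec
open import Data.Vec.Relation.Unary.All using (All; []; _∷_; all?)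
open import Function.Base using (_∘_)
open import Function.Bundles using (mk⇔)
open import Relation.Binary.PropositionalEquality
  using (_≡_; _≗_; refl; sym; trans; cong; cong₂; subst; module ≡-Reasoning)
open import Relation.Nullary using (Dec; yes; no; ¬_; contradiction; _⊎-dec_)
open import Relation.Nullary.Decidable using (decidable-stable; map′)
open import Relation.Unary using (Decidable)

open import Data.Nat.Base using (ℕ)
open import Data.Integer.Base using (+_)
open import Data.Rational.Base using (-_; _/_)
open import Function.Bundles using (_⇔_)

private
  variable
    m n : ℕ

-- Arithmetic of integer fractions with a common denominator.

-- Since `_/_` reduces to lowest terms, the two sides are compared as unnormalised fractions, where
-- the claim is a cross-multiplication identity.
+-/ : ∀ i j d .{{_ : ℕ.NonZero d}} → (i ℤ.+ j) / d ≡ i / d ℚ.+ j / d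
+-/ i j (suc d) = ℚ.toℚᵘ-injective (begin
  ℚ.toℚᵘ ((i ℤ.+ j) / suc d)                   ≈⟨ ℚ.toℚᵘ-fromℚᵘ (mkℚᵘ (i ℤ.+ j) d) ⟩
  mkℚᵘ (i ℤ.+ j) d                             ≈⟨ *≡* (cross i j (+ suc d)) ⟩
  mkℚᵘ i d ℚᵘ.+ mkℚᵘ j d                       ≈⟨ ℚᵘ.+-cong (ℚ.toℚᵘ-fromℚᵘ (mkℚᵘ i d)) (ℚ.toℚᵘ-fromℚᵘ (mkℚᵘ j d)) ⟨
  ℚ.toℚᵘ (i / suc d) ℚᵘ.+ ℚ.toℚᵘ (j / suc d)   ≈⟨ ℚ.toℚᵘ-homo-+ (i / suc d) (j / suc d) ⟨
  ℚ.toℚᵘ (i / suc d ℚ.+ j / suc d)             ∎)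
  where
  open ℚᵘ.≃-Reasoning
  cross : ∀ i j d → (i ℤ.+ j) ℤ.* (d ℤ.* d) ≡ (i ℤ.* d ℤ.+ j ℤ.* d) ℤ.* d
  cross = solve 3 (λ i j d → (i :+ j) :* (d :* d) := (i :* d :+ j :* d) :* d) refl
    where open ℤ-Solver.+-*-Solver

/-double : ∀ i d .{{_ : ℕ.NonZero d}} .{{_ : ℕ.NonZero (2 ℕ.* d)}} →
           i / (2 ℕ.* d) ≡ ½ ℚ.* (i / d)
/-double i (suc d) = ℚ.toℚᵘ-injective (begin
  ℚ.toℚᵘ (i / (2 ℕ.* suc d))          ≈⟨ ℚ.toℚᵘ-fromℚᵘ (mkℚᵘ i _) ⟩
  mkℚᵘ i _                            ≈⟨ *≡* (cong (ℤ._* + (2 ℕ.* suc d)) (sym (ℤ.*-identityˡ i))) ⟩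
  mkℚᵘ (+ 1) 1 ℚᵘ.* mkℚᵘ i d          ≈⟨ ℚᵘ.*-congˡ {mkℚᵘ (+ 1) 1} (ℚ.toℚᵘ-fromℚᵘ (mkℚᵘ i d)) ⟨
  ℚ.toℚᵘ ½ ℚᵘ.* ℚ.toℚᵘ (i / suc d)    ≈⟨ ℚ.toℚᵘ-homo-* ½ (i / suc d) ⟨
  ℚ.toℚᵘ (½ ℚ.* (i / suc d))          ∎)
  where open ℚᵘ.≃-Reasoning

neg-/ : ∀ i d .{{_ : ℕ.NonZero d}} → (ℤ.- i) / d ≡ - (i / d)
neg-/ (+ 0)       (suc d) = trans (ℚ.0/n≡0 (suc d)) (cong -_ (sym (ℚ.0/n≡0 (suc d))))
neg-/ (+ suc i)   d = refl
neg-/ ℤ.-[1+ i ]  d = sym (⁻¹-involutive (+ suc i / d))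
  where open GroupProperties ℚ.+-0-group using (⁻¹-involutive)

-- Sums and expectations, split by the first coordinate.

-- Stated for an arbitrary monoid so that it serves both the integer sums over assignments inside
-- `𝔼` and the rational sums over subsets.
foldr-allVecs : ∀ {A B : Set} {_⊕_ : B → B → B} {ε} → IsMonoid _≡_ _⊕_ ε →
  ∀ {n} (g : Vec A (suc n) → B) (a b : A) → let as = a ∷ b ∷ [] in
  List.foldr _⊕_ ε (List.map g (allVecs as (suc n))) ≡
    List.foldr _⊕_ ε (List.map (g ∘ (a ∷_)) (allVecs as n)) ⊕
    List.foldr _⊕_ ε (List.map (g ∘ (b ∷_)) (allVecs as n))
foldr-allVecs {_⊕_ = _⊕_} {ε} mon {n} g a b = begin
  Σ (List.map g (ₐ++ₛ a (ₐ++ₛ b [])))            ≡⟨ peel a (ₐ++ₛ b []) ⟩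
  Σₛ a ⊕ Σ (List.map g (ₐ++ₛ b []))              ≡⟨ cong (Σₛ a ⊕_) (trans (peel b []) (identityʳ _)) ⟩
  Σₛ a ⊕ Σₛ b                                    ∎
  where
  open ≡-Reasoning
  open IsMonoid mon using (assoc; identityˡ; identityʳ)
  Σ = List.foldr _⊕_ ε
  vs = allVecs (a ∷ b ∷ []) n
  -- `allVecs` unfolds to one block per possible head followed by `[]`; the final `[]` contributes
  -- `ε`, which `identityʳ` removes.
  ₐ++ₛ = λ s ws → List.map (s ∷_) vs ++ ws
  Σₛ = λ s → Σ (List.map (g ∘ (s ∷_)) vs)
  split : ∀ xs ys → Σ (xs ++ ys) ≡ Σ xs ⊕ Σ ys
  split []       ys = sym (identityˡ _)
  split (x ∷ xs) ys = trans (cong (x ⊕_) (split xs ys)) (sym (assoc x _ _))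
  peel : ∀ s ws → Σ (List.map g (ₐ++ₛ s ws)) ≡ Σₛ s ⊕ Σ (List.map g ws)
  peel s ws = begin
    Σ (List.map g (ₐ++ₛ s ws))                                  ≡⟨ cong Σ (List.map-++ g (List.map (s ∷_) vs) ws) ⟩
    Σ (List.map g (List.map (s ∷_) vs) ++ List.map g ws)        ≡⟨ split (List.map g (List.map (s ∷_) vs)) (List.map g ws) ⟩
    Σ (List.map g (List.map (s ∷_) vs)) ⊕ Σ (List.map g ws)     ≡⟨ cong (λ l → Σ l ⊕ _) (sym (List.map-∘ vs)) ⟩
    Σₛ s ⊕ Σ (List.map g ws)                                    ∎

𝔼-cong : {g h : Assignment n → ℤ} → g ≗ h → 𝔼 g ≡ 𝔼 h
𝔼-cong {n} g≗h = cong (λ l → ℚ._/_ (List.foldr ℤ._+_ (+ 0) l) (2 ℕ.^ n) {{ℕ.m^n≢0 2 n}})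
  (List.map-cong g≗h (allAssignments n))

𝔼-neg : (g : Assignment n → ℤ) → 𝔼 (ℤ.-_ ∘ g) ≡ - 𝔼 g
𝔼-neg {n} g = trans (cong (λ i → ℚ._/_ i (2 ℕ.^ n) {{2^n≢0}}) (Σ-neg (allAssignments n)))
                    (neg-/ (Σ (List.map g (allAssignments n))) (2 ℕ.^ n) {{2^n≢0}})
  where
  2^n≢0 = ℕ.m^n≢0 2 n
  Σ = List.foldr ℤ._+_ (+ 0)
  Σ-neg : ∀ xs → Σ (List.map (ℤ.-_ ∘ g) xs) ≡ ℤ.- Σ (List.map g xs)
  Σ-neg []       = refl
  Σ-neg (x ∷ xs) = trans (cong (λ i → ℤ.- g x ℤ.+ i) (Σ-neg xs))
                         (sym (ℤ.neg-distrib-+ (g x) _))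

-- Total expectation over the first coordinate: the denominator doubles from `2 ^ n` to `2 * 2 ^ n`,
-- which produces the factor `½`.
𝔼-∷ : (g : Assignment (suc n) → ℤ) →
      𝔼 g ≡ ½ ℚ.* (𝔼 (g ∘ (Sign.- ∷_)) ℚ.+ 𝔼 (g ∘ (Sign.+ ∷_)))
𝔼-∷ {n} g = begin
  Σ g / 2 ℕ.^ suc n                  ≡⟨ /-double (Σ g) (2 ℕ.^ n) ⟩
  ½ ℚ.* (Σ g / 2 ℕ.^ n)              ≡⟨ cong (λ i → ½ ℚ.* (i / 2 ℕ.^ n)) (foldr-allVecs ℤ.+-0-isMonoid g Sign.- Sign.+) ⟩
  ½ ℚ.* ((Σ (g ∘ (Sign.- ∷_)) ℤ.+ Σ (g ∘ (Sign.+ ∷_))) / 2 ℕ.^ n)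
                                     ≡⟨ cong (½ ℚ.*_) (+-/ (Σ (g ∘ (Sign.- ∷_))) (Σ (g ∘ (Sign.+ ∷_))) (2 ℕ.^ n)) ⟩
  ½ ℚ.* (𝔼 (g ∘ (Sign.- ∷_)) ℚ.+ 𝔼 (g ∘ (Sign.+ ∷_)))  ∎
  where
  open ≡-Reasoning
  instance
    2^n≢0 : ℕ.NonZero (2 ℕ.^ n)
    2^n≢0 = ℕ.m^n≢0 2 n
    2^1+n≢0 : ℕ.NonZero (2 ℕ.* 2 ℕ.^ n)
    2^1+n≢0 = ℕ.m^n≢0 2 (suc n)
  Σ : ∀ {k} → (Assignment k → ℤ) → ℤ
  Σ {k} h = List.foldr ℤ._+_ (+ 0) (List.map h (allAssignments k))

-- Evaluation of multilinear polynomials at rational points.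

infix 8 _[_]

-- The restriction of a polynomial that fixes its first variable at `q`.
_[_] : Multilinear (suc n) → ℚ → Multilinear n
(p [ q ]) S = p (outside ∷ S) ℚ.+ q ℚ.* p (inside ∷ S)

-- Evaluation by successive substitution instead of a sum over monomials, so that inductions on the
-- number of variables follow its recursion.
evalℚ : Multilinear n → Vec ℚ n → ℚ
evalℚ p []       = p []
evalℚ p (q ∷ qs) = evalℚ (p [ q ]) qs

evalℚ-cong : {p r : Multilinear n} → p ≗ r → evalℚ p ≗ evalℚ r
evalℚ-cong p≗r []       = p≗r []
evalℚ-cong p≗r (q ∷ qs) = evalℚ-cong
  (λ S → cong₂ (λ a b → a ℚ.+ q ℚ.* b) (p≗r (outside ∷ S)) (p≗r (inside ∷ S))) qs

evalℚ-+ : (p r : Multilinear n) (qs : Vec ℚ n) →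
          evalℚ (λ S → p S ℚ.+ r S) qs ≡ evalℚ p qs ℚ.+ evalℚ r qs
evalℚ-+ p r []       = refl
evalℚ-+ p r (q ∷ qs) = trans
  (evalℚ-cong (λ S → rearrange (p (outside ∷ S)) (r (outside ∷ S)) q (p (inside ∷ S)) (r (inside ∷ S))) qs)
  (evalℚ-+ (p [ q ]) (r [ q ]) qs)
  where
  rearrange : ∀ a b q c d → (a ℚ.+ b) ℚ.+ q ℚ.* (c ℚ.+ d) ≡ (a ℚ.+ q ℚ.* c) ℚ.+ (b ℚ.+ q ℚ.* d)
  rearrange = solve 5 (λ a b q c d →
    (a :+ b) :+ q :* (c :+ d) := (a :+ q :* c) :+ (b :+ q :* d)) refl
    where open +-*-Solver

evalℚ-* : ∀ k (p : Multilinear n) (qs : Vec ℚ n) →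
          evalℚ (λ S → k ℚ.* p S) qs ≡ k ℚ.* evalℚ p qs
evalℚ-* k p []       = refl
evalℚ-* k p (q ∷ qs) = trans
  (evalℚ-cong (λ S → rearrange k (p (outside ∷ S)) q (p (inside ∷ S))) qs)
  (evalℚ-* k (p [ q ]) qs)
  where
  rearrange : ∀ k a q c → k ℚ.* a ℚ.+ q ℚ.* (k ℚ.* c) ≡ k ℚ.* (a ℚ.+ q ℚ.* c)
  rearrange = solve 4 (λ k a q c → k :* a :+ q :* (k :* c) := k :* (a :+ q :* c)) refl
    where open +-*-Solver

evalℚ-0 : (qs : Vec ℚ n) → evalℚ (λ _ → 0ℚ) qs ≡ 0ℚ
evalℚ-0 qs = trans (evalℚ-* 0ℚ (λ _ → 0ℚ) qs) (ℚ.*-zeroˡ (evalℚ (λ _ → 0ℚ) qs))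

-- Splitting the subsets by membership of the first variable matches the monomial sum with the two
-- terms of `p [ q ]`.
sum≡evalℚ : (p : Multilinear n) (qs : Vec ℚ n) →
  List.foldr ℚ._+_ 0ℚ (List.map (λ S → p S ℚ.* ∏ ℚ._*_ 1ℚ S qs) (allSubsets n)) ≡ evalℚ p qs
sum≡evalℚ p [] = trans (ℚ.+-identityʳ _) (ℚ.*-identityʳ (p []))
sum≡evalℚ {suc n} p (q ∷ qs) = begin
  Σ (λ S → p S ℚ.* ∏ ℚ._*_ 1ℚ S (q ∷ qs))
    ≡⟨ foldr-allVecs ℚ.+-0-isMonoid (λ S → p S ℚ.* ∏ ℚ._*_ 1ℚ S (q ∷ qs)) inside outside ⟩
  Σ (λ S → p (inside ∷ S) ℚ.* (q ℚ.* ∏ ℚ._*_ 1ℚ S qs)) ℚ.+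
  Σ (λ S → p (outside ∷ S) ℚ.* (1ℚ ℚ.* ∏ ℚ._*_ 1ℚ S qs))
    ≡⟨ cong₂ ℚ._+_ (Σ-cong λ S → swap q (p (inside ∷ S)) (∏ ℚ._*_ 1ℚ S qs))
                   (Σ-cong λ S → cong (p (outside ∷ S) ℚ.*_) (ℚ.*-identityˡ (∏ ℚ._*_ 1ℚ S qs))) ⟩
  Σ (λ S → (q ℚ.* p (inside ∷ S)) ℚ.* ∏ ℚ._*_ 1ℚ S qs) ℚ.+
  Σ (λ S → p (outside ∷ S) ℚ.* ∏ ℚ._*_ 1ℚ S qs)
    ≡⟨ cong₂ ℚ._+_ (sum≡evalℚ (λ S → q ℚ.* p (inside ∷ S)) qs) (sum≡evalℚ (λ S → p (outside ∷ S)) qs) ⟩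
  evalℚ (λ S → q ℚ.* p (inside ∷ S)) qs ℚ.+ evalℚ (λ S → p (outside ∷ S)) qs
    -- `allSubsets` lists `inside` first, whereas `_[_]` puts the `outside` term first.
    ≡⟨ ℚ.+-comm (evalℚ (λ S → q ℚ.* p (inside ∷ S)) qs) _ ⟩
  evalℚ (λ S → p (outside ∷ S)) qs ℚ.+ evalℚ (λ S → q ℚ.* p (inside ∷ S)) qs
    ≡⟨ evalℚ-+ (λ S → p (outside ∷ S)) (λ S → q ℚ.* p (inside ∷ S)) qs ⟨
  evalℚ (p [ q ]) qs ∎
  where
  open ≡-Reasoning
  Σ : ∀ {k} → (Subset k → ℚ) → ℚ
  Σ {k} g = List.foldr ℚ._+_ 0ℚ (List.map g (allSubsets k))
  Σ-cong : ∀ {k} {g h : Subset k → ℚ} → g ≗ h → Σ g ≡ Σ h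
  Σ-cong {k} g≗h = cong (List.foldr ℚ._+_ 0ℚ) (List.map-cong g≗h (allSubsets k))
  swap : ∀ a b c → b ℚ.* (a ℚ.* c) ≡ (a ℚ.* b) ℚ.* c
  swap = solve 3 (λ a b c → b :* (a :* c) := (a :* b) :* c) refl
    where open +-*-Solver

coords : ℕ → Vec ℝ n → Vec ℚ n
coords k = Vec.map λ t → seq t k

-- Real addition and multiplication act termwise on sequences, so questions about `eval` reduce to
-- rational evaluation at each index.
seq-eval : (p : Multilinear n) (x : Vec ℝ n) (k : ℕ) →
           seq (eval p x) k ≡ evalℚ p (coords k x)
seq-eval {n} p x k = begin
  seq (eval p x) k
    ≡⟨ seq-sum (List.map (λ S → fromℚ (p S) * ∏ _*_ (fromℚ 1ℚ) S x) (allSubsets n)) ⟩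
  List.foldr ℚ._+_ 0ℚ (List.map (λ t → seq t k) (List.map (λ S → fromℚ (p S) * ∏ _*_ (fromℚ 1ℚ) S x) (allSubsets n)))
    ≡⟨ cong (List.foldr ℚ._+_ 0ℚ) (sym (List.map-∘ (allSubsets n))) ⟩
  List.foldr ℚ._+_ 0ℚ (List.map (λ S → p S ℚ.* seq (∏ _*_ (fromℚ 1ℚ) S x) k) (allSubsets n))
    ≡⟨ cong (List.foldr ℚ._+_ 0ℚ) (List.map-cong (λ S → cong (p S ℚ.*_) (seq-∏ S x)) (allSubsets n)) ⟩
  List.foldr ℚ._+_ 0ℚ (List.map (λ S → p S ℚ.* ∏ ℚ._*_ 1ℚ S (coords k x)) (allSubsets n))
    ≡⟨ sum≡evalℚ p (coords k x) ⟩
  evalℚ p (coords k x) ∎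
  where
  open ≡-Reasoning
  seq-sum : ∀ ts → seq (List.foldr _+_ (fromℚ 0ℚ) ts) k ≡ List.foldr ℚ._+_ 0ℚ (List.map (λ t → seq t k) ts)
  seq-sum []       = refl
  seq-sum (t ∷ ts) = cong (seq t k ℚ.+_) (seq-sum ts)
  seq-∏ : ∀ {n} (S : Subset n) (x : Vec ℝ n) →
          seq (∏ _*_ (fromℚ 1ℚ) S x) k ≡ ∏ ℚ._*_ 1ℚ S (coords k x)
  seq-∏ []            []      = refl
  seq-∏ (inside ∷ S)  (t ∷ x) = cong (seq t k ℚ.*_) (seq-∏ S x)
  seq-∏ (outside ∷ S) (t ∷ x) = cong (1ℚ ℚ.*_) (seq-∏ S x)

-- Fourier expansions at the vertices of the cube.

signℚ : Sign → ℚ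
signℚ s = (s ◃ 1) / 1

vertex : Assignment n → Vec ℚ n
vertex = Vec.map signℚ

-- The inside case of the product splits off a factor -1 from the half of the
-- expectation with first coordinate -1.
FE-[] : (c : Assignment (suc n) → Sign) (s : Sign) → FE c [ signℚ s ] ≗ FE (c ∘ (s ∷_))
FE-[] {n} c s S = trans
  (cong₂ (λ a b → a ℚ.+ signℚ s ℚ.* b) (𝔼-∷ (term (outside ∷ S)))
    (trans (𝔼-∷ (term (inside ∷ S)))
           (cong (λ a → ½ ℚ.* (a ℚ.+ A Sign.+)) (trans (𝔼-cong flip) (𝔼-neg term⁻)))))
  (select s)
  where
  term : Subset (suc n) → Assignment (suc n) → ℤ
  term T x = (c x Sign.* ∏ Sign._*_ Sign.+ T x) ◃ 1
  term⁻ : Assignment n → ℤ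
  term⁻ x = (c (Sign.- ∷ x) Sign.* ∏ Sign._*_ Sign.+ S x) ◃ 1
  A : Sign → ℚ
  A s = FE (c ∘ (s ∷_)) S
  ◃-opposite : ∀ s t → (s Sign.* opposite t) ◃ 1 ≡ ℤ.- ((s Sign.* t) ◃ 1)
  ◃-opposite Sign.- Sign.- = refl
  ◃-opposite Sign.- Sign.+ = refl
  ◃-opposite Sign.+ Sign.- = refl
  ◃-opposite Sign.+ Sign.+ = refl
  flip : ∀ x → term (inside ∷ S) (Sign.- ∷ x) ≡ ℤ.- term⁻ x
  flip x = ◃-opposite (c (Sign.- ∷ x)) (∏ Sign._*_ Sign.+ S x)
  select : ∀ s → ½ ℚ.* (A Sign.- ℚ.+ A Sign.+) ℚ.+ signℚ s ℚ.* (½ ℚ.* (- A Sign.- ℚ.+ A Sign.+)) ≡ A s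
  select Sign.- = solve 2 (λ a b → con ½ :* (a :+ b) :+ con (- 1ℚ) :* (con ½ :* (:- a :+ b)) := a)
                  refl (A Sign.-) (A Sign.+)
    where open +-*-Solver
  select Sign.+ = solve 2 (λ a b → con ½ :* (a :+ b) :+ con 1ℚ :* (con ½ :* (:- a :+ b)) := b)
                  refl (A Sign.-) (A Sign.+)
    where open +-*-Solver

-- Fixing the coordinates one at a time with `FE-[]` leaves a function of no variables, whose only
-- Fourier coefficient is its value.
evalℚ-FE : (c : Assignment n → Sign) (a : Assignment n) → evalℚ (FE c) (vertex a) ≡ signℚ (c a)
evalℚ-FE c []      = cong (_/ 1) (trans (ℤ.+-identityʳ _) (cong (_◃ 1) (Sign.*-identityʳ (c []))))
evalℚ-FE c (s ∷ a) = trans (evalℚ-cong (FE-[] c s) (vertex a)) (evalℚ-FE (c ∘ (s ∷_)) a)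

-- Values of `F f` at the vertices.

valueℚ : Formula n m → Assignment n → ℚ
valueℚ f a = evalℚ (F f) (vertex a)

valueℚ-∷ : ∀ c (f : Formula n m) a → valueℚ (c ∷ f) a ≡ signℚ (⟦ c ⟧ᶜ a) ℚ.+ valueℚ f a
valueℚ-∷ c f a = trans (evalℚ-+ (FE ⟦ c ⟧ᶜ) (F f) (vertex a))
                       (cong (ℚ._+ valueℚ f a) (evalℚ-FE ⟦ c ⟧ᶜ a))

signℚ-satisfied : ∀ (c : Clause n) a → Satisfies a c → signℚ (⟦ c ⟧ᶜ a) ≡ - 1ℚ
signℚ-satisfied c a sat with satisfies? a c
... | yes _    = refl
... | no unsat = contradiction sat unsat

signℚ-falsified : ∀ (c : Clause n) a → ¬ Satisfies a c → signℚ (⟦ c ⟧ᶜ a) ≡ 1ℚ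
signℚ-falsified c a unsat with satisfies? a c
... | yes sat = contradiction sat unsat
... | no _    = refl

-1≤signℚ : ∀ s → - 1ℚ ℚ.≤ signℚ s
-1≤signℚ Sign.- = ℚ.≤-refl
-1≤signℚ Sign.+ = ℚ.≤-trans (ℚ.nonPositive⁻¹ (- 1ℚ)) (ℚ.nonNegative⁻¹ 1ℚ)

neg-suc/1 : ∀ m → - (+ suc m / 1) ≡ - 1ℚ ℚ.+ - (+ m / 1)
neg-suc/1 m = trans (cong -_ (+-/ (+ 1) (+ m) 1)) (ℚ.neg-distrib-+ 1ℚ (+ m / 1))

valueℚ-satisfied : ∀ (f : Formula n m) {a} → All (Satisfies a) f → valueℚ f a ≡ - (+ m / 1)
valueℚ-satisfied [] {a} [] = evalℚ-0 (vertex a)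
valueℚ-satisfied {m = suc m} (c ∷ f) {a} (sat ∷ sats) = begin
  valueℚ (c ∷ f) a                     ≡⟨ valueℚ-∷ c f a ⟩
  signℚ (⟦ c ⟧ᶜ a) ℚ.+ valueℚ f a      ≡⟨ cong₂ ℚ._+_ (signℚ-satisfied c a sat) (valueℚ-satisfied f sats) ⟩
  - 1ℚ ℚ.+ - (+ m / 1)                 ≡⟨ neg-suc/1 m ⟨
  - (+ suc m / 1)                      ∎
  where open ≡-Reasoning

-m≤valueℚ : ∀ (f : Formula n m) a → - (+ m / 1) ℚ.≤ valueℚ f a
-m≤valueℚ [] a = ℚ.≤-reflexive (sym (evalℚ-0 (vertex a)))
-m≤valueℚ {m = suc m} (c ∷ f) a = begin
  - (+ suc m / 1)                      ≡⟨ neg-suc/1 m ⟩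
  - 1ℚ ℚ.+ - (+ m / 1)                 ≤⟨ ℚ.+-mono-≤ (-1≤signℚ (⟦ c ⟧ᶜ a)) (-m≤valueℚ f a) ⟩
  signℚ (⟦ c ⟧ᶜ a) ℚ.+ valueℚ f a      ≡⟨ valueℚ-∷ c f a ⟨
  valueℚ (c ∷ f) a                     ∎
  where open ℚ.≤-Reasoning

-- A falsified clause contributes 1 instead of -1, which raises the value above `-m` by at least 2.
-- Any positive gap separates it from `-m`, so a gap of 1 is enough.
1-m≤valueℚ : ∀ (f : Formula n m) a → ¬ All (Satisfies a) f → 1ℚ ℚ.+ - (+ m / 1) ℚ.≤ valueℚ f a
1-m≤valueℚ [] a unsat = contradiction [] unsat
1-m≤valueℚ {m = suc m} (c ∷ f) a unsat = begin
  1ℚ ℚ.+ - (+ suc m / 1)               ≡⟨ cong (1ℚ ℚ.+_) (neg-suc/1 m) ⟩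
  1ℚ ℚ.+ (- 1ℚ ℚ.+ - (+ m / 1))        ≤⟨ bound (satisfies? a c) ⟩
  signℚ (⟦ c ⟧ᶜ a) ℚ.+ valueℚ f a      ≡⟨ valueℚ-∷ c f a ⟨
  valueℚ (c ∷ f) a                     ∎
  where
  open ℚ.≤-Reasoning
  commute : ∀ a b c → a ℚ.+ (b ℚ.+ c) ≡ b ℚ.+ (a ℚ.+ c)
  commute = solve 3 (λ a b c → a :+ (b :+ c) := b :+ (a :+ c)) refl
    where open +-*-Solver
  bound : Dec (Satisfies a c) → 1ℚ ℚ.+ (- 1ℚ ℚ.+ - (+ m / 1)) ℚ.≤ signℚ (⟦ c ⟧ᶜ a) ℚ.+ valueℚ f a
  -- The head contributes 1 and the tail at least `-m`; the extra `- 1ℚ` in the goal is discarded as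
  -- slack.
  bound (no ¬sat) = ℚ.+-mono-≤ (ℚ.≤-reflexive (sym (signℚ-falsified c a ¬sat)))
    (ℚ.≤-trans (ℚ.≤-trans (ℚ.+-monoˡ-≤ (- (+ m / 1)) (ℚ.nonPositive⁻¹ (- 1ℚ)))
                          (ℚ.≤-reflexive (ℚ.+-identityˡ (- (+ m / 1)))))
               (-m≤valueℚ f a))
  -- The falsified clause lies in the tail, which supplies the gap, while the head contributes at
  -- least -1.
  bound (yes sat) = ℚ.≤-trans (ℚ.≤-reflexive (commute 1ℚ (- 1ℚ) (- (+ m / 1))))
    (ℚ.+-mono-≤ (-1≤signℚ (⟦ c ⟧ᶜ a)) (1-m≤valueℚ f a (λ sats → unsat (sat ∷ sats))))

-- Decidability of satisfiability.

anyAssignment? : {P : Assignment n → Set} → Decidable P → Dec (∃ P)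
anyAssignment? {zero}  P? = map′ ([] ,_) (λ { ([] , p) → p }) (P? [])
anyAssignment? {suc n} P? = map′
  [ (λ (x , p) → Sign.- ∷ x , p) , (λ (x , p) → Sign.+ ∷ x , p) ]′
  (λ { (Sign.- ∷ x , p) → inj₁ (x , p) ; (Sign.+ ∷ x , p) → inj₂ (x , p) })
  (anyAssignment? (P? ∘ (Sign.- ∷_)) ⊎-dec anyAssignment? (P? ∘ (Sign.+ ∷_)))

-- Exhaustive search makes constructive the argument by contradiction that extracts a satisfying
-- assignment from the minimum.
satisfiable? : (f : Formula n m) → Dec (Satisfiable f)
satisfiable? f = anyAssignment? λ a → all? (satisfies? a) f

-- Order, sums and products of Cauchy reals.

-- The order on reals depends only on the termwise difference of the two sequences. This moves terms
-- across an inequality with the rational ring solver at each index.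
≤-from-difference : ∀ {x y x′ y′} → (∀ k → seq y k ℚ.- seq x k ≡ seq y′ k ℚ.- seq x′ k) →
                    x ≤ y → x′ ≤ y′
≤-from-difference {x} {y} {x′} {y′} eq x≤y ε 0<ε with x≤y ε 0<ε
... | N , bound = N , λ k N≤k → begin
  seq x′ k                                        ≡⟨ split (seq x k) (seq x′ k) ⟩
  seq x k ℚ.+ (seq x′ k ℚ.- seq x k)              ≤⟨ ℚ.+-monoˡ-≤ _ (bound k N≤k) ⟩
  seq y k ℚ.+ ε ℚ.+ (seq x′ k ℚ.- seq x k)        ≡⟨ gather (seq y k) ε (seq x′ k) (seq x k) ⟩
  (seq y k ℚ.- seq x k) ℚ.+ (ε ℚ.+ seq x′ k)      ≡⟨ cong (ℚ._+ (ε ℚ.+ seq x′ k)) (eq k) ⟩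
  (seq y′ k ℚ.- seq x′ k) ℚ.+ (ε ℚ.+ seq x′ k)    ≡⟨ cancel (seq y′ k) ε (seq x′ k) ⟩
  seq y′ k ℚ.+ ε                                  ∎
  where
  open ℚ.≤-Reasoning
  open +-*-Solver
  split : ∀ a b → b ≡ a ℚ.+ (b ℚ.- a)
  split = solve 2 (λ a b → b := a :+ (b :- a)) refl
  gather : ∀ y e b a → y ℚ.+ e ℚ.+ (b ℚ.- a) ≡ (y ℚ.- a) ℚ.+ (e ℚ.+ b)
  gather = solve 4 (λ y e b a → y :+ e :+ (b :- a) := (y :- a) :+ (e :+ b)) refl
  cancel : ∀ y e b → (y ℚ.- b) ℚ.+ (e ℚ.+ b) ≡ y ℚ.+ e
  cancel = solve 3 (λ y e b → (y :- b) :+ (e :+ b) := y :+ e) refl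

p≤∣p∣ : ∀ p → p ℚ.≤ ℚ.∣ p ∣
p≤∣p∣ p with ℚ.≤-total 0ℚ p
... | inj₁ 0≤p = ℚ.≤-reflexive (sym (ℚ.0≤p⇒∣p∣≡p 0≤p))
... | inj₂ p≤0 = ℚ.≤-trans p≤0 (ℚ.0≤∣p∣ p)

-- Past the index where all terms are within 1 of each other, every term is at most one more than
-- `seq x N`.
bounded-above : ∀ x → ∃ λ B → 0ℚ ℚ.≤ B × ∃ λ N → ∀ k → N ℕ.≤ k → seq x k ℚ.≤ B
bounded-above x with cauchy x 1ℚ (ℚ.positive⁻¹ 1ℚ)
... | N , close = 1ℚ ℚ.+ ℚ.∣ seq x N ∣
  , ℚ.+-mono-≤ (ℚ.nonNegative⁻¹ 1ℚ) (ℚ.0≤∣p∣ (seq x N))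
  , N , λ k N≤k → begin
    seq x k                                 ≡⟨ split (seq x k) (seq x N) ⟩
    (seq x k ℚ.- seq x N) ℚ.+ seq x N       ≤⟨ ℚ.+-mono-≤ (ℚ.≤-trans (p≤∣p∣ (seq x k ℚ.- seq x N)) (close k N N≤k ℕ.≤-refl)) (p≤∣p∣ (seq x N)) ⟩
    1ℚ ℚ.+ ℚ.∣ seq x N ∣                    ∎
  where
  open ℚ.≤-Reasoning
  split : ∀ a b → a ≡ (a ℚ.- b) ℚ.+ b
  split = solve 2 (λ a b → a := (a :- b) :+ b) refl
    where open +-*-Solver

0≤-+ : ∀ {x y} → fromℚ 0ℚ ≤ x → fromℚ 0ℚ ≤ y → fromℚ 0ℚ ≤ x + y
0≤-+ {x} {y} 0≤x 0≤y ε 0<ε with 0≤x (½ ℚ.* ε) 0<½ε | 0≤y (½ ℚ.* ε) 0<½ε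
  where 0<½ε = ℚ.positive⁻¹ (½ ℚ.* ε) {{ℚ.pos*pos⇒pos ½ ε {{ℚ.positive 0<ε}}}}
... | M , boundˣ | N , boundʸ = M ⊔ N , λ k ≤k → ℚ.≤-trans
  (ℚ.+-mono-≤ (boundˣ k (ℕ.m⊔n≤o⇒m≤o M N ≤k)) (boundʸ k (ℕ.m⊔n≤o⇒n≤o M N ≤k)))
  (ℚ.≤-reflexive (regroup (seq x k) (seq y k) ε))
  where
  regroup : ∀ a b e → (a ℚ.+ ½ ℚ.* e) ℚ.+ (b ℚ.+ ½ ℚ.* e) ≡ (a ℚ.+ b) ℚ.+ e
  regroup = solve 3 (λ a b e → (a :+ con ½ :* e) :+ (b :+ con ½ :* e) := (a :+ b) :+ e) refl
    where open +-*-Solver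

0≤p*q : ∀ {p q} → 0ℚ ℚ.≤ p → 0ℚ ℚ.≤ q → 0ℚ ℚ.≤ p ℚ.* q
0≤p*q {p} {q} 0≤p 0≤q = ℚ.nonNegative⁻¹ (p ℚ.* q)
  {{ℚ.nonNeg*nonNeg⇒nonNeg p {{ℚ.nonNegative 0≤p}} q {{ℚ.nonNegative 0≤q}}}}

p≤q⇒0≤q-p : ∀ {p q} → p ℚ.≤ q → 0ℚ ℚ.≤ q ℚ.- p
p≤q⇒0≤q-p {p} {q} p≤q = subst (ℚ._≤ q ℚ.- p) (ℚ.+-inverseʳ p) (ℚ.+-monoˡ-≤ (- p) p≤q)

-- If 0 ≤ p use p q + δ B = p (q + δ) + δ (B - p), otherwise
-- p q + δ B = (- p) (B - q) + (p + δ) B.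
0≤-*-approx : ∀ {p q δ B} → 0ℚ ℚ.≤ δ → 0ℚ ℚ.≤ B → 0ℚ ℚ.≤ p ℚ.+ δ → 0ℚ ℚ.≤ q ℚ.+ δ →
              p ℚ.≤ B → q ℚ.≤ B → 0ℚ ℚ.≤ p ℚ.* q ℚ.+ δ ℚ.* B
0≤-*-approx {p} {q} {δ} {B} 0≤δ 0≤B -δ≤p -δ≤q p≤B q≤B with ℚ.≤-total 0ℚ p
... | inj₁ 0≤p = ℚ.≤-trans
  (ℚ.+-mono-≤ (0≤p*q 0≤p -δ≤q) (0≤p*q 0≤δ (p≤q⇒0≤q-p p≤B)))
  (ℚ.≤-reflexive (solve 4 (λ p q d B → p :* (q :+ d) :+ d :* (B :- p) := p :* q :+ d :* B) refl p q δ B))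
  where open +-*-Solver
... | inj₂ p≤0 = ℚ.≤-trans
  (ℚ.+-mono-≤ (0≤p*q (ℚ.neg-antimono-≤ p≤0) (p≤q⇒0≤q-p q≤B)) (0≤p*q -δ≤p 0≤B))
  (ℚ.≤-reflexive (solve 4 (λ p q d B → (:- p) :* (B :- q) :+ (p :+ d) :* B := p :* q :+ d :* B) refl p q δ B))
  where open +-*-Solver

p≤q+p : ∀ p {q} → 0ℚ ℚ.≤ q → p ℚ.≤ q ℚ.+ p
p≤q+p p {q} 0≤q = subst (ℚ._≤ q ℚ.+ p) (ℚ.+-identityˡ p) (ℚ.+-monoˡ-≤ p 0≤q)

p≤p+q : ∀ p {q} → 0ℚ ℚ.≤ q → p ℚ.≤ p ℚ.+ q
p≤p+q p {q} 0≤q = subst (p ℚ.≤_) (ℚ.+-comm q p) (p≤q+p p 0≤q)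

common-bound : ∀ x y → ∃ λ B → 0ℚ ℚ.≤ B × ∃ λ N → ∀ k → N ℕ.≤ k → seq x k ℚ.≤ B × seq y k ℚ.≤ B
common-bound x y =
  let B , 0≤B , M , x≤B = bounded-above x
      C , 0≤C , N , y≤C = bounded-above y
  -- Both bounds are nonnegative, so their sum dominates each of them.
  in B ℚ.+ C , ℚ.+-mono-≤ 0≤B 0≤C , M ⊔ N , λ k ≤k →
    ℚ.≤-trans (x≤B k (ℕ.m⊔n≤o⇒m≤o M N ≤k)) (p≤p+q B 0≤C) ,
    ℚ.≤-trans (y≤C k (ℕ.m⊔n≤o⇒n≤o M N ≤k)) (p≤q+p C 0≤B)

-- The choice is `ε / (1 + B)`; the added 1 keeps the divisor positive when `B` is 0.
tolerance : ∀ B ε → 0ℚ ℚ.≤ B → 0ℚ ℚ.< ε → ∃ λ δ → 0ℚ ℚ.< δ × δ ℚ.* B ℚ.≤ ε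
tolerance B ε 0≤B 0<ε = δ , 0<δ , (begin
  δ ℚ.* B                ≤⟨ ℚ.*-monoˡ-≤-nonNeg δ {{ℚ.nonNegative (ℚ.<⇒≤ 0<δ)}} (p≤q+p B (ℚ.nonNegative⁻¹ 1ℚ)) ⟩
  δ ℚ.* (1ℚ ℚ.+ B)       ≡⟨ ℚ.*-assoc ε r (1ℚ ℚ.+ B) ⟩
  ε ℚ.* (r ℚ.* (1ℚ ℚ.+ B)) ≡⟨ cong (ε ℚ.*_) (ℚ.*-inverseˡ (1ℚ ℚ.+ B) {{1+B≢0}}) ⟩
  ε ℚ.* 1ℚ               ≡⟨ ℚ.*-identityʳ ε ⟩
  ε                      ∎)
  where
  open ℚ.≤-Reasoning
  1+B>0 : ℚ.Positive (1ℚ ℚ.+ B)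
  1+B>0 = ℚ.positive (ℚ.+-mono-<-≤ (ℚ.positive⁻¹ 1ℚ) 0≤B)
  1+B≢0 : ℚ.NonZero (1ℚ ℚ.+ B)
  1+B≢0 = ℚ.pos⇒nonZero (1ℚ ℚ.+ B) {{1+B>0}}
  r δ : ℚ
  r = ℚ.1/_ (1ℚ ℚ.+ B) {{1+B≢0}}
  δ = ε ℚ.* r
  0<δ : 0ℚ ℚ.< δ
  0<δ = ℚ.positive⁻¹ δ
    {{ℚ.pos*pos⇒pos ε {{ℚ.positive 0<ε}} r {{ℚ.1/pos⇒pos (1ℚ ℚ.+ B) {{1+B>0}}}}}}

-- The terms of a nonnegative real may be slightly negative. Once they are at least `- δ` and at
-- most `B`, `0≤-*-approx` bounds their products below by `- δ B`, and `tolerance` makes this at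
-- least `- ε`.
0≤-* : ∀ {x y} → fromℚ 0ℚ ≤ x → fromℚ 0ℚ ≤ y → fromℚ 0ℚ ≤ x * y
0≤-* {x} {y} 0≤x 0≤y ε 0<ε =
  let B , 0≤B , L , xy≤B = common-bound x y
      δ , 0<δ , δB≤ε     = tolerance B ε 0≤B 0<ε
      M , -δ≤x           = 0≤x δ 0<δ
      N , -δ≤y           = 0≤y δ 0<δ
  in L ⊔ (M ⊔ N) , λ k ≤k →
  let MN≤k      = ℕ.m⊔n≤o⇒n≤o L (M ⊔ N) ≤k
      x≤B , y≤B = xy≤B k (ℕ.m⊔n≤o⇒m≤o L (M ⊔ N) ≤k)
  in ℚ.≤-trans
       (0≤-*-approx (ℚ.<⇒≤ 0<δ) 0≤B
         (-δ≤x k (ℕ.m⊔n≤o⇒m≤o M N MN≤k)) (-δ≤y k (ℕ.m⊔n≤o⇒n≤o M N MN≤k)) x≤B y≤B)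
       (ℚ.+-monoʳ-≤ (seq x k ℚ.* seq y k) δB≤ε)

-- From the vertices to the whole cube.

-- A multilinear polynomial is affine in its first variable, so the identity holds coefficientwise
-- and carries over by linearity of `evalℚ`.
evalℚ-interpolate : (p : Multilinear (suc n)) (t : ℚ) (qs : Vec ℚ n) → evalℚ p (t ∷ qs) ≡
  (½ ℚ.* (t ℚ.+ 1ℚ)) ℚ.* evalℚ (p [ signℚ Sign.+ ]) qs ℚ.+ (½ ℚ.* (1ℚ ℚ.- t)) ℚ.* evalℚ (p [ signℚ Sign.- ]) qs
evalℚ-interpolate p t qs = begin
  evalℚ (p [ t ]) qs
    ≡⟨ evalℚ-cong (λ S → interpolate t (p (outside ∷ S)) (p (inside ∷ S))) qs ⟩
  evalℚ (λ S → u ℚ.* (p [ signℚ Sign.+ ]) S ℚ.+ w ℚ.* (p [ signℚ Sign.- ]) S) qs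
    ≡⟨ evalℚ-+ (λ S → u ℚ.* (p [ signℚ Sign.+ ]) S) (λ S → w ℚ.* (p [ signℚ Sign.- ]) S) qs ⟩
  evalℚ (λ S → u ℚ.* (p [ signℚ Sign.+ ]) S) qs ℚ.+ evalℚ (λ S → w ℚ.* (p [ signℚ Sign.- ]) S) qs
    ≡⟨ cong₂ ℚ._+_ (evalℚ-* u (p [ signℚ Sign.+ ]) qs) (evalℚ-* w (p [ signℚ Sign.- ]) qs) ⟩
  u ℚ.* evalℚ (p [ signℚ Sign.+ ]) qs ℚ.+ w ℚ.* evalℚ (p [ signℚ Sign.- ]) qs ∎
  where
  open ≡-Reasoning
  u = ½ ℚ.* (t ℚ.+ 1ℚ)
  w = ½ ℚ.* (1ℚ ℚ.- t)
  interpolate : ∀ t a b → a ℚ.+ t ℚ.* b ≡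
    (½ ℚ.* (t ℚ.+ 1ℚ)) ℚ.* (a ℚ.+ signℚ Sign.+ ℚ.* b) ℚ.+ (½ ℚ.* (1ℚ ℚ.- t)) ℚ.* (a ℚ.+ signℚ Sign.- ℚ.* b)
  interpolate = solve 3 (λ t a b → a :+ t :* b :=
    (con ½ :* (t :+ con 1ℚ)) :* (a :+ con 1ℚ :* b) :+
    (con ½ :* (con 1ℚ :- t)) :* (a :+ con (- 1ℚ) :* b)) refl
    where open +-*-Solver

fromℚ-mono : ∀ {p q} → p ℚ.≤ q → fromℚ p ≤ fromℚ q
fromℚ-mono {p} {q} p≤q ε 0<ε = 0 , λ _ _ → ℚ.≤-trans p≤q (p≤p+q q (ℚ.<⇒≤ 0<ε))

-- The weights `u` and `w` sum to 1, so `e - v` equals `u (a - v) + w (b - v)`, and all four factors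
-- are nonnegative reals.
≤-interpolate : ∀ {v t a b e} → fromℚ (- 1ℚ) ≤ t × t ≤ fromℚ 1ℚ → fromℚ v ≤ a → fromℚ v ≤ b →
  (∀ k → seq e k ≡ (½ ℚ.* (seq t k ℚ.+ 1ℚ)) ℚ.* seq a k ℚ.+ (½ ℚ.* (1ℚ ℚ.- seq t k)) ℚ.* seq b k) →
  fromℚ v ≤ e
≤-interpolate {v} {t} {a} {b} {e} (-1≤t , t≤1) v≤a v≤b e≡ =
  ≤-from-difference {fromℚ 0ℚ} {u * excess a + w * excess b} {fromℚ v} {e}
    (λ k → trans (rearrange (seq t k) (seq a k) (seq b k) v) (cong (ℚ._- v) (sym (e≡ k))))
    (0≤-+ {u * excess a} {w * excess b}
      (0≤-* {u} {excess a} 0≤u (0≤excess a v≤a)) (0≤-* {w} {excess b} 0≤w (0≤excess b v≤b)))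
  where
  open +-*-Solver
  u w : ℝ
  u = fromℚ ½ * (t + fromℚ 1ℚ)
  w = fromℚ ½ * (fromℚ 1ℚ + fromℚ (- 1ℚ) * t)
  excess : ℝ → ℝ
  excess y = y + fromℚ (- v)
  0≤excess : ∀ y → fromℚ v ≤ y → fromℚ 0ℚ ≤ excess y
  0≤excess y = ≤-from-difference {fromℚ v} {y} {fromℚ 0ℚ} {excess y}
    (λ k → solve 2 (λ e v → e :- v := (e :+ (:- v)) :- con 0ℚ) refl (seq y k) v)
  0≤½ : fromℚ 0ℚ ≤ fromℚ ½
  0≤½ = fromℚ-mono (ℚ.nonNegative⁻¹ ½)
  0≤u : fromℚ 0ℚ ≤ u
  0≤u = 0≤-* {fromℚ ½} {t + fromℚ 1ℚ} 0≤½
    (≤-from-difference {fromℚ (- 1ℚ)} {t} {fromℚ 0ℚ} {t + fromℚ 1ℚ}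
      (λ k → solve 1 (λ t → t :- con (- 1ℚ) := (t :+ con 1ℚ) :- con 0ℚ) refl (seq t k)) -1≤t)
  0≤w : fromℚ 0ℚ ≤ w
  0≤w = 0≤-* {fromℚ ½} {fromℚ 1ℚ + fromℚ (- 1ℚ) * t} 0≤½
    (≤-from-difference {t} {fromℚ 1ℚ} {fromℚ 0ℚ} {fromℚ 1ℚ + fromℚ (- 1ℚ) * t}
      (λ k → solve 1 (λ t → con 1ℚ :- t := (con 1ℚ :+ con (- 1ℚ) :* t) :- con 0ℚ) refl (seq t k)) t≤1)
  rearrange : ∀ t a b v →
    (½ ℚ.* (t ℚ.+ 1ℚ)) ℚ.* (a ℚ.+ - v) ℚ.+ (½ ℚ.* (1ℚ ℚ.+ (- 1ℚ) ℚ.* t)) ℚ.* (b ℚ.+ - v) ℚ.- 0ℚ ≡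
    ((½ ℚ.* (t ℚ.+ 1ℚ)) ℚ.* a ℚ.+ (½ ℚ.* (1ℚ ℚ.- t)) ℚ.* b) ℚ.- v
  rearrange = solve 4 (λ t a b v →
    (con ½ :* (t :+ con 1ℚ)) :* (a :+ (:- v)) :+
    (con ½ :* (con 1ℚ :+ con (- 1ℚ) :* t)) :* (b :+ (:- v)) :- con 0ℚ :=
    ((con ½ :* (t :+ con 1ℚ)) :* a :+ (con ½ :* (con 1ℚ :- t)) :* b) :- v) refl

vertex-bound⇒cube-bound : ∀ v (p : Multilinear n) → (∀ a → v ℚ.≤ evalℚ p (vertex a)) →
                          ∀ x → InCube x → fromℚ v ≤ eval p x
vertex-bound⇒cube-bound v p bound [] [] ε 0<ε = 0 , λ k _ → begin
  v                        ≤⟨ bound [] ⟩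
  p []                     ≤⟨ p≤p+q (p []) (ℚ.<⇒≤ 0<ε) ⟩
  p [] ℚ.+ ε               ≡⟨ cong (ℚ._+ ε) (seq-eval p [] k) ⟨
  seq (eval p []) k ℚ.+ ε  ∎
  where open ℚ.≤-Reasoning
vertex-bound⇒cube-bound v p bound (t ∷ x) (t∈I ∷ x∈cube) =
  ≤-interpolate {v} {t} {eval (p [ signℚ Sign.+ ]) x} {eval (p [ signℚ Sign.- ]) x} {eval p (t ∷ x)}
    t∈I (face Sign.+) (face Sign.-) λ k →
    trans (seq-eval p (t ∷ x) k)
      (trans (evalℚ-interpolate p (seq t k) (coords k x))
             (cong₂ (λ a b → (½ ℚ.* (seq t k ℚ.+ 1ℚ)) ℚ.* a ℚ.+ (½ ℚ.* (1ℚ ℚ.- seq t k)) ℚ.* b)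
               (sym (seq-eval (p [ signℚ Sign.+ ]) x k)) (sym (seq-eval (p [ signℚ Sign.- ]) x k))))
  where
  face : ∀ s → fromℚ v ≤ eval (p [ signℚ s ]) x
  -- `evalℚ p (vertex (s ∷ a))` unfolds to `evalℚ (p [ signℚ s ]) (vertex a)`, so the vertex bound
  -- for the face is an instance of the given one.
  face s = vertex-bound⇒cube-bound v (p [ signℚ s ]) (λ a → bound (s ∷ a)) x x∈cube

vertexℝ : Assignment n → Vec ℝ n
vertexℝ = Vec.map (fromℚ ∘ signℚ)

vertexℝ∈cube : (a : Assignment n) → InCube (vertexℝ a)
vertexℝ∈cube []      = []
vertexℝ∈cube (s ∷ a) = (fromℚ-mono (-1≤signℚ s) , fromℚ-mono (signℚ≤1 s)) ∷ vertexℝ∈cube a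
  where
  signℚ≤1 : ∀ s → signℚ s ℚ.≤ 1ℚ
  signℚ≤1 Sign.- = -1≤signℚ Sign.+
  signℚ≤1 Sign.+ = ℚ.≤-refl

seq-eval-vertexℝ : (p : Multilinear n) (a : Assignment n) (k : ℕ) →
                   seq (eval p (vertexℝ a)) k ≡ evalℚ p (vertex a)
seq-eval-vertexℝ p a k = trans (seq-eval p (vertexℝ a) k)
  (cong (evalℚ p) (sym (Vec.map-∘ (λ t → seq t k) (fromℚ ∘ signℚ) a)))

-- Satisfiability and the minimum value `-m`.

satisfiable⇒minimum : (f : Formula n m) → Satisfiable f →
                      IsMinimum InCube (eval (F f)) (fromℚ (- (+ m / 1)))
satisfiable⇒minimum {m = m} f (a , sats) =
  -- At a rational vertex the sequence of values is constant, so index 0 works for every `ε`.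
  (vertexℝ a , vertexℝ∈cube a , λ ε 0<ε → 0 , λ k _ → attained k ε 0<ε) ,
  vertex-bound⇒cube-bound (- (+ m / 1)) (F f) (-m≤valueℚ f)
  where
  attained : ∀ k ε → 0ℚ ℚ.< ε → ℚ.∣ seq (eval (F f) (vertexℝ a)) k ℚ.- - (+ m / 1) ∣ ℚ.≤ ε
  attained k ε 0<ε = begin
    ℚ.∣ seq (eval (F f) (vertexℝ a)) k ℚ.- - (+ m / 1) ∣
      ≡⟨ cong (λ q → ℚ.∣ q ℚ.- - (+ m / 1) ∣) (trans (seq-eval-vertexℝ (F f) a k) (valueℚ-satisfied f sats)) ⟩
    ℚ.∣ - (+ m / 1) ℚ.- - (+ m / 1) ∣
      ≡⟨ cong ℚ.∣_∣ (ℚ.+-inverseʳ (- (+ m / 1))) ⟩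
    0ℚ
      <⟨ 0<ε ⟩
    ε ∎
    where open ℚ.≤-Reasoning

-- With tolerance `¼` in both hypotheses, a common late index would give `1 ≤ ¼ + ¼`.
1+v≤x⇒x≉v : ∀ {x v} → fromℚ (1ℚ ℚ.+ v) ≤ x → ¬ x ≈ fromℚ v
1+v≤x⇒x≉v {x} {v} 1+v≤x x≈v with 1+v≤x ¼ 0<¼ | x≈v ¼ 0<¼
  where
  ¼ = ½ ℚ.* ½
  0<¼ = ℚ.positive⁻¹ ¼
... | M , lower | N , close = contradiction (ℚ.<-≤-trans (ℚ.+-monoʳ-< ½ (ℚ.positive⁻¹ ½)) 1≤½) (ℚ.<-irrefl refl)
  where
  k = M ⊔ N
  ¼ = ½ ℚ.* ½
  open ℚ.≤-Reasoning
  open +-*-Solver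
  1≤½ : 1ℚ ℚ.≤ ½
  1≤½ = begin
    1ℚ                                 ≡⟨ solve 1 (λ v → con 1ℚ := (con 1ℚ :+ v) :- v) refl v ⟩
    (1ℚ ℚ.+ v) ℚ.- v                   ≤⟨ ℚ.+-monoˡ-≤ (- v) (lower k (ℕ.m≤m⊔n M N)) ⟩
    (seq x k ℚ.+ ¼) ℚ.- v              ≡⟨ solve 2 (λ e v → (e :+ con ¼) :- v := (e :- v) :+ con ¼) refl (seq x k) v ⟩
    (seq x k ℚ.- v) ℚ.+ ¼              ≤⟨ ℚ.+-monoˡ-≤ ¼ (ℚ.≤-trans (p≤∣p∣ (seq x k ℚ.- v)) (close k (ℕ.m≤n⊔m M N))) ⟩
    ½                                  ∎

-- If no assignment satisfied `f`, every vertex value would be at least `1 - m`, hence so would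
-- every value on the cube, contradicting that `-m` is attained.
minimum⇒satisfiable : (f : Formula n m) → IsMinimum InCube (eval (F f)) (fromℚ (- (+ m / 1))) →
                      Satisfiable f
minimum⇒satisfiable {m = m} f ((x , x∈cube , Fx≈-m) , _) =
  decidable-stable (satisfiable? f) λ unsat →
    1+v≤x⇒x≉v {eval (F f) x} {v = - (+ m / 1)}
      (vertex-bound⇒cube-bound (1ℚ ℚ.+ - (+ m / 1)) (F f)
        (λ a → 1-m≤valueℚ f a (λ sats → unsat (a , sats))) x x∈cube)
      Fx≈-m

theorem2 : (n m : ℕ) (f : Formula n m) → Satisfiable f ⇔ IsMinimum InCube (eval (F f)) (fromℚ (- (+ m / 1)))
theorem2 n m f = mk⇔ (satisfiable⇒minimum f) (minimum⇒satisfiable f)
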